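{- Let $A_n=n!\,[2(n+1)H_n-4n]$ with $H_n=\sum_{i=1}^n\frac1i$ (the total number of pivot comparisons made by Quicksort over all $n!$ orderings of an array of size $n$), and let $L_n$ be the number of preference lists in $[n]^n$ with exactly $n-1$ lucky cars. Then both sequences $f_n=A_n$ and $f_n=L_n$ satisfy, for all $n\geq 2$, the recurrence $$f_n=2n f_{n-1}-n(n-1)f_{n-2}+2(n-1)!,$$ with $f_0=f_1=0$.
   Context: For $n\in\mathbb{N}$ let $[n]=\{1,\dots,n\}$. A preference list of length $n$ is a tuple $\alpha=(p_1,\dots,p_n)\in[n]^n$. Cars $1,2,\dots,n$ enter, in this order, a one-way street with parking spots $1,\dots,n$. Car $i$ parks in the first unoccupied spot numbered greater than or equal to $p_i$, if such a spot exists; otherwise car $i$ is unable to park (and the remaining cars continue in order). Car $i$ is lucky if it parks in its preferred spot $p_i$; a car that is unable to park is not lucky. $\mathrm{Lucky}(\alpha)$ is the number of lucky cars of $\alpha$. It is not required that all cars be able to park. Set $L_n=|\{\alpha\in[n]^n:\mathrm{Lucky}(\alpha)=n-1\}|$, with $L_0=0$. Quicksort: given an array of $n\ge 1$ elements, Quicksort selects a pivot element, makes $n-1$ pivot comparisons to split the other elements into a left array and a right array, and recurses on each. The expected number $Q_n$ of pivot comparisons on a uniformly random ordering is determined by $Q_0=0$ and $Q_n=(n-1)+\frac1n\sum_{k=1}^n (Q_{k-1}+Q_{n-k})$ for $n\geq 1$, with closed form $Q_n=2(n+1)H_n-4n$ (where $H_0=0$); and $A_n=n!\,Q_n$. -}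

module Defs where

open import Data.Nat.Base as ℕ using (ℕ; zero; suc; _∸_; _!; _≥_)
import Data.Nat.Properties as ℕ
open import Data.Integer.Base using (+_)
open import Data.Rational.Base using (ℚ; 0ℚ; _/_; _+_; _*_; _-_)
open import Data.Fin.Base using (Fin)
open import Data.Fin.Properties as Fin using (_≤?_)
open import Data.Fin.Subset using (Subset; ⊥; ⁅_⁆; _∪_)
open import Data.Fin.Subset.Properties using (_∈?_)
open import Data.List.Base as List using (List; allFin; cartesianProductWith)
open import Data.Maybe.Base using (Maybe; just; nothing)
open import Data.Maybe.Properties using (≡-dec)
open import Data.Product.Base using (_×_; _,_)
open import Data.Vec.Base using (Vec; []; _∷_; zip; count)
open import Relation.Binary.PropositionalEquality using (_≡_)
open import Relation.Nullary.Decidable using (¬?; _×-dec_)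

-- Spots 1, …, n are represented by Fin n, so all indices are shifted down by
-- one.  A Subset n records which spots are occupied.

-- allFin n is increasing, so find returns the smallest suitable spot.
firstFree : ∀ {n} → Subset n → Fin n → Maybe (Fin n)
firstFree {n} occupied p =
  List.find (λ s → (p ≤? s) ×-dec ¬? (s ∈? occupied)) (allFin n)

occupy : ∀ {n} → Subset n → Maybe (Fin n) → Subset n
occupy occupied nothing  = occupied
occupy occupied (just s) = occupied ∪ ⁅ s ⁆

-- The spot taken by each car in turn; nothing means the car cannot park.
park : ∀ {n m} → Subset n → Vec (Fin n) m → Vec (Maybe (Fin n)) m
park occupied []       = []
park occupied (p ∷ ps) = s ∷ park (occupy occupied s) ps
  where s = firstFree occupied p

PreferenceList : ℕ → Set
PreferenceList n = Vec (Fin n) n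

Lucky : ∀ {n} → PreferenceList n → ℕ
Lucky α = count (λ (p , s) → ≡-dec Fin._≟_ s (just p)) (zip α (park ⊥ α))

-- Every element of [n]^m, each listed exactly once.
tuples : ∀ n m → List (Vec (Fin n) m)
tuples n zero    = List.[ [] ]
tuples n (suc m) = cartesianProductWith _∷_ (allFin n) (tuples n m)

preferenceLists : ∀ n → List (PreferenceList n)
preferenceLists n = tuples n n

-- The case n = 0 is separate because ∸ truncates: the empty list has
-- 0 = 0 ∸ 1 lucky cars, whereas L₀ = 0.
L : ℕ → ℕ
L zero      = 0
L n@(suc _) =
  List.length (List.filter (λ α → Lucky α ℕ.≟ n ∸ 1) (preferenceLists n))

fromℕ : ℕ → ℚ
fromℕ n = + n / 1

H : ℕ → ℚ
H zero    = 0ℚ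
H (suc n) = H n + + 1 / suc n

A : ℕ → ℚ
A n = fromℕ (n !) * (fromℕ (2 ℕ.* (n ℕ.+ 1)) * H n - fromℕ (4 ℕ.* n))

SatisfiesRecurrence : (ℕ → ℚ) → Set
SatisfiesRecurrence f =
  f 0 ≡ 0ℚ × f 1 ≡ 0ℚ ×
  (∀ n → n ≥ 2 →
    f n ≡ fromℕ (2 ℕ.* n) * f (n ∸ 1)
          - fromℕ (n ℕ.* (n ∸ 1)) * f (n ∸ 2)
          + fromℕ (2 ℕ.* (n ∸ 1) !))

{-# OPTIONS --safe #-}
module Submission where

-- Both sequences are shown to be equal: L n = A n.  The state of the street is the set U
-- of occupied spots; as long as no car has been unlucky, the number m of remaining cars
-- equals the number of vacant spots.  An unlucky car that still parks leaves (m - 1)! ways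
-- to let the remaining cars be lucky, and one that cannot park leaves m!.  Solving the
-- resulting linear recursion over U one preferred spot p at a time, the number of ways to
-- continue with exactly one unlucky car is
--
--   Σ_p m! ((m + 1) / (t_p + 1) + H_{t_p}) - m! (n + m),
--
-- where t_p is the number of vacant spots at or beyond p.  For the empty street
-- t_p = n, ..., 1, and the sum is the closed form of A n.

open import Defs
open import Data.Fin.Subset using (⊥)
open import Data.Nat.Base as ℕ using (ℕ; zero; suc; _!; _∸_; s≤s)
import Data.Nat.Properties as ℕ
open import Data.Product.Base using (_×_; _,_)
open import Relation.Binary.PropositionalEquality
open ≡-Reasoning

-- Counting in ℕ

module Counting where

  open import Algebra.Properties.CommutativeMonoid.Sum ℕ.+-0-commutativeMonoid using (sum)
  open import Algebra.Properties.CommutativeSemigroup ℕ.+-commutativeSemigroup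
    using (interchange; x∙yz≈y∙xz)
  open import Data.Bool.Base using (true; false)
  open import Data.Empty using (⊥-elim)
  open import Data.Fin.Base as Fin using (Fin; zero; suc)
  import Data.Fin.Properties as Fin
  open import Data.Fin.Subset using (Subset; inside; outside; ⁅_⁆; _∪_; ∁; ∣_∣; _∈_; _∉_)
  open import Data.Fin.Subset.Properties using (_∈?_; ∪-identityʳ; drop-there)
  open import Data.List.Base as List
    using ([]; _∷_; List; allFin; tabulate; length; filter; map; cartesianProductWith)
  open import Data.List.Properties using (filter-++; filter-none; filter-≐; length-++)
  open import Data.List.Relation.Unary.All using (universal)
  open import Data.Maybe.Base using (just; nothing)
  open import Data.Maybe.Properties using (≡-dec)
  open import Data.Nat.Base using (pred; _+_; _*_; z≤n)
  open import Data.Nat.Properties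
  open import Data.Nat.Tactic.RingSolver using (solve-∀)
  open import Data.Product.Base using (∃; proj₂)
  open import Data.Vec.Base using (Vec; []; _∷_; zip; count; here; there)
  open import Data.Vec.Properties using (count≤n)
  open import Function.Base using (_∘_)
  open import Relation.Nullary.Decidable using (yes; no; does; dec-true; dec-false; ¬?; _×-dec_)
  open import Relation.Nullary.Negation using (¬_; contradiction)
  open import Relation.Unary using (Pred; Decidable)

  private
    variable
      n m : ℕ

  -- Sums over the vacant and over the occupied spots.

  vacancies : Subset n → ℕ
  vacancies U = ∣ ∁ U ∣

  sumFree : Subset n → (Fin n → ℕ) → ℕ
  sumFree []            φ = 0
  sumFree (inside  ∷ U) φ = sumFree U (φ ∘ suc)
  sumFree (outside ∷ U) φ = φ zero + sumFree U (φ ∘ suc)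

  sumTaken : Subset n → (Fin n → ℕ) → ℕ
  sumTaken []            φ = 0
  sumTaken (inside  ∷ U) φ = φ zero + sumTaken U (φ ∘ suc)
  sumTaken (outside ∷ U) φ = sumTaken U (φ ∘ suc)

  sum-split : (U : Subset n) (φ : Fin n → ℕ) → sum φ ≡ sumFree U φ + sumTaken U φ
  sum-split []            φ = refl
  sum-split (inside ∷ U)  φ = begin
    φ zero + sum (φ ∘ suc)                                    ≡⟨ cong (φ zero +_) (sum-split U (φ ∘ suc)) ⟩
    φ zero + (sumFree U (φ ∘ suc) + sumTaken U (φ ∘ suc))     ≡⟨ x∙yz≈y∙xz (φ zero) (sumFree U (φ ∘ suc)) _ ⟩
    sumFree U (φ ∘ suc) + (φ zero + sumTaken U (φ ∘ suc))     ∎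
  sum-split (outside ∷ U) φ =
    trans (cong (φ zero +_) (sum-split U (φ ∘ suc))) (sym (+-assoc (φ zero) _ _))

  sumFree-cong : (U : Subset n) {φ ψ : Fin n → ℕ} →
    (∀ s → s ∉ U → φ s ≡ ψ s) → sumFree U φ ≡ sumFree U ψ
  sumFree-cong []            eq = refl
  sumFree-cong (inside  ∷ U) eq = sumFree-cong U λ s s∉U → eq (suc s) (s∉U ∘ drop-there)
  sumFree-cong (outside ∷ U) eq =
    cong₂ _+_ (eq zero λ ()) (sumFree-cong U λ s s∉U → eq (suc s) (s∉U ∘ drop-there))

  sumTaken-cong : (U : Subset n) {φ ψ : Fin n → ℕ} →
    (∀ s → s ∈ U → φ s ≡ ψ s) → sumTaken U φ ≡ sumTaken U ψ
  sumTaken-cong []            eq = refl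
  sumTaken-cong (inside  ∷ U) eq =
    cong₂ _+_ (eq zero here) (sumTaken-cong U λ s s∈U → eq (suc s) (there s∈U))
  sumTaken-cong (outside ∷ U) eq = sumTaken-cong U λ s s∈U → eq (suc s) (there s∈U)

  sumFree-+ : (U : Subset n) (φ ψ : Fin n → ℕ) →
    sumFree U (λ s → φ s + ψ s) ≡ sumFree U φ + sumFree U ψ
  sumFree-+ []            φ ψ = refl
  sumFree-+ (inside  ∷ U) φ ψ = sumFree-+ U (φ ∘ suc) (ψ ∘ suc)
  sumFree-+ (outside ∷ U) φ ψ =
    trans (cong (φ zero + ψ zero +_) (sumFree-+ U (φ ∘ suc) (ψ ∘ suc))) (interchange (φ zero) (ψ zero) (sumFree U (φ ∘ suc)) _)

  sumFree-const : (U : Subset n) (c : ℕ) → sumFree U (λ _ → c) ≡ vacancies U * c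
  sumFree-const []            c = refl
  sumFree-const (inside  ∷ U) c = sumFree-const U c
  sumFree-const (outside ∷ U) c = cong (c +_) (sumFree-const U c)

  sumTaken-zero : (U : Subset n) → sumTaken U (λ _ → 0) ≡ 0
  sumTaken-zero []            = refl
  sumTaken-zero (inside  ∷ U) = sumTaken-zero U
  sumTaken-zero (outside ∷ U) = sumTaken-zero U

  vacancies-∪ : (U : Subset n) (s : Fin n) → s ∉ U → suc (vacancies (U ∪ ⁅ s ⁆)) ≡ vacancies U
  vacancies-∪ (inside  ∷ U) zero    s∉U = contradiction here s∉U
  vacancies-∪ (outside ∷ U) zero    s∉U = cong (suc ∘ vacancies) (∪-identityʳ U)
  vacancies-∪ (inside  ∷ U) (suc s) s∉U = vacancies-∪ U s (s∉U ∘ there)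
  vacancies-∪ (outside ∷ U) (suc s) s∉U = cong suc (vacancies-∪ U s (s∉U ∘ there))

  vacancies-⊥ : ∀ n → vacancies (⊥ {n}) ≡ n
  vacancies-⊥ zero    = refl
  vacancies-⊥ (suc n) = cong suc (vacancies-⊥ n)

  -- Vacant spots at or beyond a preferred spot.

  vacanciesFrom : Subset n → Fin n → ℕ
  vacanciesFrom (x ∷ U) zero    = vacancies (x ∷ U)
  vacanciesFrom (x ∷ U) (suc p) = vacanciesFrom U p

  vacancies-nonempty : (U : Subset n) → vacancies U ≢ 0 → ∃ λ s → s ∉ U
  vacancies-nonempty []            ≢0 = contradiction refl ≢0
  vacancies-nonempty (outside ∷ U) ≢0 = zero , λ ()
  vacancies-nonempty (inside  ∷ U) ≢0 with s , s∉U ← vacancies-nonempty U ≢0 = suc s , s∉U ∘ drop-there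

  vacancies≡0 : (U : Subset n) → vacancies U ≡ 0 → ∀ s → ¬ s ∉ U
  vacancies≡0 (inside ∷ U) ≡0 zero    s∉U = s∉U here
  vacancies≡0 (inside ∷ U) ≡0 (suc s) s∉U = vacancies≡0 U ≡0 s (s∉U ∘ there)

  vacanciesFrom-nonempty : (U : Subset n) (p : Fin n) → vacanciesFrom U p ≢ 0 →
    ∃ λ s → p Fin.≤ s × s ∉ U
  vacanciesFrom-nonempty (x ∷ U) zero    ≢0 with s , s∉U ← vacancies-nonempty (x ∷ U) ≢0 = s , z≤n , s∉U
  vacanciesFrom-nonempty (x ∷ U) (suc p) ≢0 with s , p≤s , s∉U ← vacanciesFrom-nonempty U p ≢0 =
    suc s , s≤s p≤s , s∉U ∘ drop-there

  vacanciesFrom≡0 : (U : Subset n) (p : Fin n) → vacanciesFrom U p ≡ 0 →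
    ∀ s → p Fin.≤ s → ¬ s ∉ U
  vacanciesFrom≡0 (x ∷ U) zero    ≡0 s       _         = vacancies≡0 (x ∷ U) ≡0 s
  vacanciesFrom≡0 (x ∷ U) (suc p) ≡0 (suc s) (s≤s p≤s) s∉U = vacanciesFrom≡0 U p ≡0 s p≤s (s∉U ∘ there)

  -- Linear search and the first free spot.

  module _ {a p} {A : Set a} {P : Pred A p} (P? : Decidable P) where

    find-just : ∀ xs {x} → List.find P? xs ≡ just x → P x
    find-just (y ∷ xs) eq with P? y
    find-just (y ∷ xs) refl | yes py = py
    find-just (y ∷ xs) eq   | no  _  = find-just xs eq

    find-tabulate-nothing : ∀ {n} (f : Fin n → A) → List.find P? (tabulate f) ≡ nothing → ∀ i → ¬ P (f i)
    find-tabulate-nothing {suc n} f eq i with P? (f zero)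
    find-tabulate-nothing {suc n} f () i       | yes _
    find-tabulate-nothing {suc n} f eq zero    | no ¬p = ¬p
    find-tabulate-nothing {suc n} f eq (suc i) | no _  = find-tabulate-nothing (f ∘ suc) eq i

    find-tabulate-least : ∀ {n} (f : Fin n → A) i → P (f i) → (∀ j → j Fin.< i → ¬ P (f j)) →
      List.find P? (tabulate f) ≡ just (f i)
    find-tabulate-least f zero    pi _ rewrite dec-true (P? (f zero)) pi = refl
    find-tabulate-least f (suc i) pi least rewrite dec-false (P? (f zero)) (least zero (s≤s z≤n)) =
      find-tabulate-least (f ∘ suc) i pi λ j j<i → least (suc j) (s≤s j<i)

  firstFree-free : (U : Subset n) (p : Fin n) → p ∉ U → firstFree U p ≡ just p
  firstFree-free U p p∉U =
    -- `allFin n` unfolds to `tabulate` of the identity. Every spot before `p` already fails the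
    -- test `p ≤ s`, so `p` is the least hit.
    find-tabulate-least (λ s → (p Fin.≤? s) ×-dec ¬? (s ∈? U)) (λ s → s) p (≤-refl , p∉U)
      λ j j<p (p≤j , _) → <⇒≱ j<p p≤j

  firstFree-just : (U : Subset n) (p : Fin n) {s : Fin n} → firstFree U p ≡ just s →
    p Fin.≤ s × s ∉ U
  firstFree-just {n} U p = find-just (λ s → (p Fin.≤? s) ×-dec ¬? (s ∈? U)) (allFin n)

  firstFree-nothing : (U : Subset n) (p : Fin n) → firstFree U p ≡ nothing →
    ∀ s → ¬ (p Fin.≤ s × s ∉ U)
  firstFree-nothing U p = find-tabulate-nothing (λ s → (p Fin.≤? s) ×-dec ¬? (s ∈? U)) (λ s → s)

  -- Recursion on the preference of the first car.

  lucky : Subset n → Vec (Fin n) m → ℕ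
  lucky U α = count (λ (p , s) → ≡-dec Fin._≟_ s (just p)) (zip α (park U α))

  lucky-free : (U : Subset n) (p : Fin n) (α : Vec (Fin n) m) → p ∉ U →
    lucky U (p ∷ α) ≡ suc (lucky (U ∪ ⁅ p ⁆) α)
  lucky-free U p α p∉U
    rewrite firstFree-free U p p∉U | dec-true (≡-dec Fin._≟_ (just p) (just p)) refl = refl

  -- The search returns only vacant spots, so it cannot return an occupied preference: such a car is
  -- unlucky whether or not it parks.
  lucky-taken : (U : Subset n) (p : Fin n) (α : Vec (Fin n) m) → p ∈ U →
    lucky U (p ∷ α) ≡ lucky (occupy U (firstFree U p)) α
  lucky-taken U p α p∈U
    rewrite dec-false (≡-dec Fin._≟_ (firstFree U p) (just p))
              (λ eq → let (_ , p∉U) = firstFree-just U p eq in p∉U p∈U) = refl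

  -- Stating the condition additively avoids truncated subtraction. The total `k` is kept apart from
  -- `m` because removing an unlucky first car lowers the number of cars but not the required total.
  unlucky? : (U : Subset n) (e k : ℕ) → Decidable (λ (α : Vec (Fin n) m) → lucky U α + e ≡ k)
  unlucky? U e k α = lucky U α + e ≟ k

  -- Exactly e of the m arriving cars are unlucky.
  arrivals : ℕ → Subset n → ℕ → ℕ
  arrivals {n} e U m = length (filter (unlucky? U e m) (tuples n m))

  module _ {a b p q} {A : Set a} {B : Set b} {P : Pred B p} {Q : Pred A q}
           (P? : Decidable P) (Q? : Decidable Q) where

    length-filter-map : (f : A → B) → (∀ x → does (P? (f x)) ≡ does (Q? x)) →
      ∀ xs → length (filter P? (map f xs)) ≡ length (filter Q? xs)
    length-filter-map f eq []       = refl
    length-filter-map f eq (x ∷ xs) with does (P? (f x)) | does (Q? x) | eq x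
    ... | true  | _ | refl = cong suc (length-filter-map f eq xs)
    ... | false | _ | refl = length-filter-map f eq xs

  length-filter-product : ∀ {a b c p n} {A : Set a} {B : Set b} {C : Set c} {P : Pred C p}
    (P? : Decidable P) (f : A → B → C) (g : Fin n → A) (ys : List B) →
    length (filter P? (cartesianProductWith f (tabulate g) ys))
      ≡ sum (λ i → length (filter P? (map (f (g i)) ys)))
  length-filter-product {n = zero}  P? f g ys = refl
  length-filter-product {n = suc n} P? f g ys = begin
    length (filter P? (map (f (g zero)) ys List.++ rest))
      ≡⟨ cong length (filter-++ P? (map (f (g zero)) ys) rest) ⟩
    length (filter P? (map (f (g zero)) ys) List.++ filter P? rest)
      ≡⟨ length-++ (filter P? (map (f (g zero)) ys)) ⟩
    length (filter P? (map (f (g zero)) ys)) + length (filter P? rest)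
      ≡⟨ cong (length (filter P? (map (f (g zero)) ys)) +_) (length-filter-product P? f (g ∘ suc) ys) ⟩
    _ ∎
    where rest = cartesianProductWith f (tabulate (g ∘ suc)) ys

  -- The first car is lucky exactly when its preference is vacant. After an unlucky first car the
  -- remaining `m` cars must still reach the total `suc m`.
  arrivals-suc : (e : ℕ) (U : Subset n) (m : ℕ) →
    arrivals e U (suc m) ≡
      sumFree U (λ p → arrivals e (U ∪ ⁅ p ⁆) m) +
      sumTaken U (λ p → length (filter (unlucky? (occupy U (firstFree U p)) e (suc m)) (tuples n m)))
  arrivals-suc {n} e U m = begin
    arrivals e U (suc m)
      ≡⟨ length-filter-product (unlucky? U e (suc m)) _∷_ (λ p → p) (tuples n m) ⟩
    sum preferring
      ≡⟨ sum-split U preferring ⟩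
    sumFree U preferring + sumTaken U preferring
      ≡⟨ cong₂ _+_
          -- `does (suc l + e ≟ suc m)` computes to `does (l + e ≟ m)`, so a lucky car is removed
          -- from both sides of the condition at once.
          (sumFree-cong U λ p p∉U →
            length-filter-map (unlucky? U e (suc m)) (unlucky? (U ∪ ⁅ p ⁆) e m) (p ∷_)
            (λ α → cong (λ l → does (l + e ≟ suc m)) (lucky-free U p α p∉U)) (tuples n m))
          (sumTaken-cong U λ p p∈U →
            length-filter-map (unlucky? U e (suc m)) (unlucky? (occupy U (firstFree U p)) e (suc m)) (p ∷_)
            (λ α → cong (λ l → does (l + e ≟ suc m)) (lucky-taken U p α p∈U)) (tuples n m)) ⟩
    _ ∎
    where
    preferring : Fin n → ℕ
    preferring p = length (filter (unlucky? U e (suc m)) (map (p ∷_) (tuples n m)))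

  -- After an unlucky first car, `m` cars would have to contain `suc m` lucky ones, so the sum over
  -- occupied spots vanishes.
  arrivals-0-suc : (U : Subset n) (m : ℕ) →
    arrivals 0 U (suc m) ≡ sumFree U (λ p → arrivals 0 (U ∪ ⁅ p ⁆) m)
  arrivals-0-suc {n} U m = begin
    arrivals 0 U (suc m) ≡⟨ arrivals-suc 0 U m ⟩
    sumFree U (λ p → arrivals 0 (U ∪ ⁅ p ⁆) m) + _
      ≡⟨ cong (sumFree U (λ p → arrivals 0 (U ∪ ⁅ p ⁆) m) +_)
           (trans (sumTaken-cong U λ p _ → none p) (sumTaken-zero U)) ⟩
    sumFree U (λ p → arrivals 0 (U ∪ ⁅ p ⁆) m) + 0 ≡⟨ +-identityʳ _ ⟩
    sumFree U (λ p → arrivals 0 (U ∪ ⁅ p ⁆) m) ∎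
    where
    none : ∀ p → length (filter (unlucky? (occupy U (firstFree U p)) 0 (suc m)) (tuples n m)) ≡ 0
    none p = cong length (filter-none (unlucky? V 0 (suc m)) (universal tooMany (tuples n m)))
      where
      V = occupy U (firstFree U p)
      tooMany : (α : Vec (Fin n) m) → lucky V α + 0 ≢ suc m
      tooMany α eq = <⇒≱ (≤-reflexive (sym (trans (sym (+-identityʳ (lucky V α))) eq)))
        (count≤n (λ (p , s) → ≡-dec Fin._≟_ s (just p)) (zip α (park V α)))

  arrivals-1-suc : (U : Subset n) (m : ℕ) →
    arrivals 1 U (suc m) ≡
      sumFree U (λ p → arrivals 1 (U ∪ ⁅ p ⁆) m) +
      sumTaken U (λ p → arrivals 0 (occupy U (firstFree U p)) m)
  arrivals-1-suc {n} U m = trans (arrivals-suc 1 U m)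
    (cong (sumFree U (λ p → arrivals 1 (U ∪ ⁅ p ⁆) m) +_) (sumTaken-cong U λ p _ →
      cong length (filter-≐ (unlucky? (occupy U (firstFree U p)) 1 (suc m))
                            (unlucky? (occupy U (firstFree U p)) 0 m)
                            ((λ eq → suc-injective (trans (sym (+-suc _ 0)) eq)) ,
                             (λ eq → trans (+-suc _ 0) (cong suc eq)))
                            (tuples n m))))

  -- Lucky cars choose distinct vacant spots in order, which gives `(e + m) ! / e !` ways, where `e`
  -- is the surplus of spots over cars. The hypothesis `e ! ≡ 1` removes the division and covers
  -- both cases needed: `e = 0` after an unlucky car has parked, `e = 1` after one has failed to
  -- park.
  arrivals-0 : ∀ e m (U : Subset n) → e ! ≡ 1 → vacancies U ≡ e + m → arrivals 0 U m ≡ (e + m) !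
  arrivals-0 e zero    U e!≡1 eq = sym (trans (cong _! (+-identityʳ e)) e!≡1)
  arrivals-0 e (suc m) U e!≡1 eq = begin
    arrivals 0 U (suc m)                       ≡⟨ arrivals-0-suc U m ⟩
    sumFree U (λ p → arrivals 0 (U ∪ ⁅ p ⁆) m) ≡⟨ sumFree-cong U (λ p p∉U → arrivals-0 e m _ e!≡1
                                                    (suc-injective (trans (vacancies-∪ U p p∉U) eq′))) ⟩
    sumFree U (λ _ → (e + m) !)                ≡⟨ sumFree-const U _ ⟩
    vacancies U * (e + m) !                    ≡⟨ cong (_* (e + m) !) eq′ ⟩
    (suc (e + m)) !                            ≡⟨ cong _! (sym (+-suc e m)) ⟩
    (e + suc m) !                              ∎
    where
    eq′ : vacancies U ≡ suc (e + m)
    eq′ = trans eq (+-suc e m)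

  -- The number of all-lucky arrivals of the m cars following an unlucky car, when t of
  -- the m + 1 vacant spots are at or beyond its preference (for t = 0 it cannot park).
  completions : ℕ → ℕ → ℕ
  completions m zero    = suc m !
  completions m (suc t) = m !

  -- The search fails exactly when no vacant spot lies at or beyond `p`, so two of the four cases
  -- are contradictory. In the other two, `arrivals-0` applies with surplus 1 and 0 respectively.
  arrivals-completions : (U : Subset n) (p : Fin n) → vacancies U ≡ suc m →
    arrivals 0 (occupy U (firstFree U p)) m ≡ completions m (vacanciesFrom U p)
  arrivals-completions {m = m} U p eq with firstFree U p in found | vacanciesFrom U p in t
  ... | nothing | zero  = arrivals-0 1 m U refl eq
  ... | nothing | suc _ = ⊥-elim (firstFree-nothing U p found _
                            (proj₂ (vacanciesFrom-nonempty U p λ t≡0 → 0≢1+n (trans (sym t≡0) t))))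
  ... | just s  | zero  = let (p≤s , s∉U) = firstFree-just U p found in
                          ⊥-elim (vacanciesFrom≡0 U p t s p≤s s∉U)
  ... | just s  | suc _ = let (_ , s∉U) = firstFree-just U p found in
                          arrivals-0 0 m _ refl (suc-injective (trans (vacancies-∪ U s s∉U) eq))

  -- A vacant `p` counts itself among the vacant spots at or beyond it, so each summand is `m !`.
  -- This is what extends the sum over occupied spots in `arrivals-1` to a sum over all spots.
  sumFree-completions : (U : Subset n) → vacancies U ≡ suc m →
    sumFree U (λ p → completions m (vacanciesFrom U p)) ≡ suc m !
  sumFree-completions {m = m} U eq = begin
    sumFree U (λ p → completions m (vacanciesFrom U p)) ≡⟨ sumFree-cong U (λ p p∉U → parks p p∉U) ⟩
    sumFree U (λ _ → m !)                               ≡⟨ sumFree-const U (m !) ⟩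
    vacancies U * m !                                   ≡⟨ cong (_* m !) eq ⟩
    suc m !                                             ∎
    where
    parks : ∀ p → p ∉ U → completions m (vacanciesFrom U p) ≡ m !
    parks p p∉U with vacanciesFrom U p in t
    ... | zero  = ⊥-elim (vacanciesFrom≡0 U p t p ≤-refl p∉U)
    ... | suc _ = refl

  -- The contribution of a preferred spot with r vacant spots before it and t at or after it;
  -- the recursion is the one that closes up under totalWeight-step.
  weight : ℕ → ℕ → ℕ
  weight r       zero    = suc r !
  weight zero    (suc t) = suc t * weight zero t + t !
  weight (suc r) (suc t) = suc t * weight (suc r) t + suc r * weight r (suc t) + (suc r + t) !

  -- One formula for all the clauses of `weight`: where `pred` truncates, its term carries the
  -- factor 0. The boundary value at `t = 0` fits because `(r + 2)! = (r + 1) (r + 1)! + (r + 1)!`.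
  weight-rec : ∀ r t → r + t ≡ suc m →
    weight r t ≡ t * weight r (pred t) + r * weight (pred r) t + completions m t
  weight-rec (suc r) zero refl rewrite +-identityʳ r = +-comm (suc r !) (suc r * suc r !)
  weight-rec zero (suc t) refl = cong (_+ t !) (sym (+-identityʳ _))
  weight-rec (suc r) (suc t) refl =
    cong (λ k → suc t * weight (suc r) t + suc r * weight r (suc t) + k !) (sym (+-suc r t))

  -- r counts the vacant spots to the left of U.
  totalWeight : ℕ → Subset n → ℕ
  totalWeight r []            = 0
  totalWeight r (inside  ∷ U) = weight r (vacancies U) + totalWeight r U
  totalWeight r (outside ∷ U) = weight r (suc (vacancies U)) + totalWeight (suc r) U

  -- The next lucky car takes a vacant spot of U, or one of the r vacant spots to its left;
  -- the completions account for the next car being unlucky.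
  totalWeight-step : ∀ r (U : Subset n) → r + vacancies U ≡ suc m →
    sumFree U (λ s → totalWeight r (U ∪ ⁅ s ⁆)) + r * totalWeight (pred r) U
      + sum (λ p → completions m (vacanciesFrom U p)) ≡ totalWeight r U
  totalWeight-step r [] eq = trans (+-identityʳ _) (*-zeroʳ r)
  totalWeight-step {m = m} r (inside ∷ U) eq = begin
    sumFree U (λ s → weight r (vacancies (U ∪ ⁅ s ⁆)) + totalWeight r (U ∪ ⁅ s ⁆))
      + r * (weight (pred r) v + totalWeight (pred r) U) + (completions m v + C)
      ≡⟨ cong (λ x → x + r * (weight (pred r) v + totalWeight (pred r) U) + (completions m v + C)) (begin
          sumFree U (λ s → weight r (vacancies (U ∪ ⁅ s ⁆)) + totalWeight r (U ∪ ⁅ s ⁆))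
            ≡⟨ sumFree-+ U _ _ ⟩
          sumFree U (λ s → weight r (vacancies (U ∪ ⁅ s ⁆))) + T
            -- Whichever vacant spot of `U` is taken, the head spot sees one vacancy fewer at or
            -- beyond it, so its weight changes by the same amount `v` times over.
            ≡⟨ cong (_+ T) (trans (sumFree-cong U λ s s∉U → cong (weight r ∘ pred) (vacancies-∪ U s s∉U))
                                  (sumFree-const U _)) ⟩
          v * weight r (pred v) + T ∎) ⟩
    v * weight r (pred v) + T + r * (weight (pred r) v + totalWeight (pred r) U) + (completions m v + C)
      ≡⟨ regroup (v * weight r (pred v)) T r (weight (pred r) v) (totalWeight (pred r) U) (completions m v) C ⟩
    (v * weight r (pred v) + r * weight (pred r) v + completions m v) + (T + r * totalWeight (pred r) U + C)
      ≡⟨ cong₂ _+_ (sym (weight-rec r v eq)) (totalWeight-step r U eq) ⟩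
    weight r v + totalWeight r U ∎
    where
    v = vacancies U
    T = sumFree U (λ s → totalWeight r (U ∪ ⁅ s ⁆))
    C = sum (λ p → completions m (vacanciesFrom U p))
    regroup : ∀ a b r c d e f → a + b + r * (c + d) + (e + f) ≡ (a + r * c + e) + (b + r * d + f)
    regroup = solve-∀
  totalWeight-step {m = m} r (outside ∷ U) eq = begin
    (weight r (vacancies (U ∪ ⊥)) + totalWeight r (U ∪ ⊥))
      + sumFree U (λ s → weight r (suc (vacancies (U ∪ ⁅ s ⁆))) + totalWeight (suc r) (U ∪ ⁅ s ⁆))
      + r * (weight (pred r) (suc v) + totalWeight (suc (pred r)) U) + (completions m (suc v) + C)
      ≡⟨ cong₃ (λ x y z → x + y + z + (completions m (suc v) + C))
           (cong (λ V → weight r (vacancies V) + totalWeight r V) (∪-identityʳ U))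
           (trans (sumFree-+ U _ _) (cong (_+ T)
             (trans (sumFree-cong U λ s s∉U → cong (weight r) (vacancies-∪ U s s∉U)) (sumFree-const U _))))
           (trans (*-distribˡ-+ r _ _) (cong (r * weight (pred r) (suc v) +_) (r*totalWeight r))) ⟩
    (weight r v + totalWeight r U) + (v * weight r v + T) + (r * weight (pred r) (suc v) + r * totalWeight r U)
      + (completions m (suc v) + C)
      -- A car taking the vacant head spot contributes one more copy of `weight r v` and of
      -- `totalWeight r U`. These raise the coefficients `v` and `r` to `suc v` and `suc r`, as the
      -- recursions for the head and for the tail require.
      ≡⟨ regroup (weight r v) (totalWeight r U) v T (r * weight (pred r) (suc v)) r (completions m (suc v)) C ⟩
    (suc v * weight r v + r * weight (pred r) (suc v) + completions m (suc v))
      + (T + suc r * totalWeight r U + C)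
      ≡⟨ cong₂ _+_ (sym (weight-rec r (suc v) eq)) (totalWeight-step (suc r) U (trans (sym (+-suc r v)) eq)) ⟩
    weight r (suc v) + totalWeight (suc r) U ∎
    where
    v = vacancies U
    T = sumFree U (λ s → totalWeight (suc r) (U ∪ ⁅ s ⁆))
    C = sum (λ p → completions m (vacanciesFrom U p))
    cong₃ : ∀ (f : ℕ → ℕ → ℕ → ℕ) {a a′ b b′ c c′} → a ≡ a′ → b ≡ b′ → c ≡ c′ → f a b c ≡ f a′ b′ c′
    cong₃ f refl refl refl = refl
    -- `suc (pred r)` differs from `r` only at `r = 0`, where the factor `r` cancels the difference.
    r*totalWeight : ∀ r → r * totalWeight (suc (pred r)) U ≡ r * totalWeight r U
    r*totalWeight zero    = refl
    r*totalWeight (suc r) = refl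
    regroup : ∀ w u v t x r c d → (w + u) + (v * w + t) + (x + r * u) + (c + d)
                                ≡ (suc v * w + x + c) + (t + suc r * u + d)
    regroup = solve-∀

  -- On a full street each of the `n` spots has weight `weight 0 0`, which is 1.
  totalWeight-full : (U : Subset n) → vacancies U ≡ 0 → totalWeight 0 U ≡ n
  totalWeight-full []           eq = refl
  totalWeight-full (inside ∷ U) eq rewrite eq = cong suc (totalWeight-full U eq)

  -- The correction `c m = m ! * (n + m)` satisfies `c (m + 1) = (m + 1) * c m + (m + 1)!`. The
  -- first part places one `c m` on each vacant spot, ready for the induction hypothesis. The second
  -- is the sum of `κ` over the vacant spots, so the inhomogeneous term runs over all spots and
  -- `totalWeight-step` applies.
  arrivals-1 : ∀ m (U : Subset n) → vacancies U ≡ m →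
    arrivals 1 U m + m ! * (n + m) ≡ totalWeight 0 U
  -- With no car left, `arrivals 1 U 0` computes to 0 and only the correction `n` remains.
  arrivals-1 {n} zero U eq = trans (trans (*-identityˡ (n + 0)) (+-identityʳ n)) (sym (totalWeight-full U eq))
  arrivals-1 {n} (suc m) U eq = begin
    arrivals 1 U (suc m) + suc m ! * (n + suc m)
      ≡⟨ cong (_+ suc m ! * (n + suc m)) (arrivals-1-suc U m) ⟩
    F + sumTaken U (λ p → arrivals 0 (occupy U (firstFree U p)) m) + suc m ! * (n + suc m)
      ≡⟨ cong (λ x → F + x + suc m ! * (n + suc m))
           (sumTaken-cong U λ p _ → arrivals-completions U p eq) ⟩
    F + sumTaken U κ + suc m ! * (n + suc m)
      ≡⟨ regroup F (sumTaken U κ) (m !) m n ⟩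
    F + suc m * (m ! * (n + m)) + (suc m ! + sumTaken U κ)
      ≡⟨ cong₂ (λ x y → F + x * (m ! * (n + m)) + (y + sumTaken U κ)) (sym eq) (sym (sumFree-completions U eq)) ⟩
    F + vacancies U * (m ! * (n + m)) + (sumFree U κ + sumTaken U κ)
      ≡⟨ cong₂ (λ x y → F + x + y) (sym (sumFree-const U _)) (sym (sum-split U κ)) ⟩
    F + sumFree U (λ _ → m ! * (n + m)) + sum κ
      ≡⟨ cong (_+ sum κ) (sym (sumFree-+ U _ _)) ⟩
    sumFree U (λ s → arrivals 1 (U ∪ ⁅ s ⁆) m + m ! * (n + m)) + sum κ
      ≡⟨ cong (_+ sum κ) (sumFree-cong U λ s s∉U →
           arrivals-1 m (U ∪ ⁅ s ⁆) (suc-injective (trans (vacancies-∪ U s s∉U) eq))) ⟩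
    sumFree U (λ s → totalWeight 0 (U ∪ ⁅ s ⁆)) + sum κ
      ≡⟨ cong (_+ sum κ) (sym (+-identityʳ _)) ⟩
    sumFree U (λ s → totalWeight 0 (U ∪ ⁅ s ⁆)) + 0 + sum κ
      ≡⟨ totalWeight-step 0 U eq ⟩
    totalWeight 0 U ∎
    where
    F = sumFree U (λ p → arrivals 1 (U ∪ ⁅ p ⁆) m)
    κ : Fin n → ℕ
    κ p = completions m (vacanciesFrom U p)
    regroup : ∀ f t x m n → f + t + (suc m * x) * (n + suc m) ≡ f + suc m * (x * (n + m)) + (suc m * x + t)
    regroup = solve-∀

  L-arrivals : ∀ n → L (suc n) ≡ arrivals 1 (⊥ {suc n}) (suc n)
  L-arrivals n = cong length (filter-≐ (λ α → Lucky α ≟ n) (unlucky? ⊥ 1 (suc n))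
    ((λ {α} eq → trans (+-comm (Lucky α) 1) (cong suc eq)) ,
     (λ {α} eq → suc-injective (trans (+-comm 1 (Lucky α)) eq)))
    (preferenceLists (suc n)))

open Counting

-- Closed forms in ℚ

open import Data.Integer.Base as ℤ using (+_; 1ℤ)
import Data.Integer.Properties as ℤ
import Data.Integer.Tactic.RingSolver as ℤ
open import Data.Rational.Base using (ℚ; 0ℚ; 1ℚ; _/_; _+_; _*_; _-_; -_; toℚᵘ)
open import Data.Rational.Properties using
  (+-identityʳ; +-comm; *-zeroʳ; toℚᵘ-injective; toℚᵘ-fromℚᵘ; toℚᵘ-homo-+; toℚᵘ-homo-*)
open import Data.Rational.Solver using (module +-*-Solver)
open import Data.Rational.Unnormalised.Base as ℚᵘ using (mkℚᵘ; *≡*)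
import Data.Rational.Unnormalised.Properties as ℚᵘ
open +-*-Solver

-- The embedding of the naturals in the rationals, by way of unnormalised fractions.

toℚᵘ-fromℕ : ∀ n → toℚᵘ (fromℕ n) ℚᵘ.≃ mkℚᵘ (+ n) 0
toℚᵘ-fromℕ n = toℚᵘ-fromℚᵘ (mkℚᵘ (+ n) 0)

fromℕ-+ : ∀ m n → fromℕ (m ℕ.+ n) ≡ fromℕ m + fromℕ n
fromℕ-+ m n = toℚᵘ-injective (R.begin
  toℚᵘ (fromℕ (m ℕ.+ n))              R.≈⟨ toℚᵘ-fromℕ (m ℕ.+ n) ⟩
  mkℚᵘ (+ (m ℕ.+ n)) 0                R.≈⟨ *≡* (identity (+ m) (+ n)) ⟩
  mkℚᵘ (+ m) 0 ℚᵘ.+ mkℚᵘ (+ n) 0      R.≈⟨ ℚᵘ.+-cong (toℚᵘ-fromℕ m) (toℚᵘ-fromℕ n) ⟨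
  toℚᵘ (fromℕ m) ℚᵘ.+ toℚᵘ (fromℕ n)  R.≈⟨ toℚᵘ-homo-+ (fromℕ m) (fromℕ n) ⟨
  toℚᵘ (fromℕ m + fromℕ n)            R.∎)
  where
  module R = ℚᵘ.≃-Reasoning
  identity : ∀ i j → (i ℤ.+ j) ℤ.* 1ℤ ≡ (i ℤ.* 1ℤ ℤ.+ j ℤ.* 1ℤ) ℤ.* 1ℤ
  identity = ℤ.solve-∀

fromℕ-* : ∀ m n → fromℕ (m ℕ.* n) ≡ fromℕ m * fromℕ n
fromℕ-* m n = toℚᵘ-injective (R.begin
  toℚᵘ (fromℕ (m ℕ.* n))              R.≈⟨ toℚᵘ-fromℕ (m ℕ.* n) ⟩
  mkℚᵘ (+ (m ℕ.* n)) 0                R.≈⟨ *≡* (cong (ℤ._* 1ℤ) (ℤ.pos-* m n)) ⟩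
  mkℚᵘ (+ m) 0 ℚᵘ.* mkℚᵘ (+ n) 0      R.≈⟨ ℚᵘ.*-cong (toℚᵘ-fromℕ m) (toℚᵘ-fromℕ n) ⟨
  toℚᵘ (fromℕ m) ℚᵘ.* toℚᵘ (fromℕ n)  R.≈⟨ toℚᵘ-homo-* (fromℕ m) (fromℕ n) ⟨
  toℚᵘ (fromℕ m * fromℕ n)            R.∎)
  where module R = ℚᵘ.≃-Reasoning

fromℕ-suc : ∀ n → fromℕ (suc n) ≡ fromℕ n + 1ℚ
fromℕ-suc n = trans (fromℕ-+ 1 n) (+-comm 1ℚ (fromℕ n))

fromℕ-! : ∀ n → fromℕ (suc n !) ≡ (fromℕ n + 1ℚ) * fromℕ (n !)
fromℕ-! n = trans (fromℕ-* (suc n) (n !)) (cong (_* fromℕ (n !)) (fromℕ-suc n))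

[1+n]*1/[1+n]≡1 : ∀ n → (fromℕ n + 1ℚ) * (+ 1 / suc n) ≡ 1ℚ
[1+n]*1/[1+n]≡1 n = trans (cong (_* (+ 1 / suc n)) (sym (fromℕ-suc n))) (toℚᵘ-injective (R.begin
  toℚᵘ (fromℕ (suc n) * (+ 1 / suc n))           R.≈⟨ toℚᵘ-homo-* (fromℕ (suc n)) (+ 1 / suc n) ⟩
  toℚᵘ (fromℕ (suc n)) ℚᵘ.* toℚᵘ (+ 1 / suc n)   R.≈⟨ ℚᵘ.*-cong (toℚᵘ-fromℕ (suc n)) (toℚᵘ-fromℚᵘ (mkℚᵘ (+ 1) n)) ⟩
  mkℚᵘ (+ suc n) 0 ℚᵘ.* mkℚᵘ (+ 1) n             R.≈⟨ *≡* (identity (+ suc n)) ⟩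
  mkℚᵘ (+ 1) 0                                   R.∎))
  where
  module R = ℚᵘ.≃-Reasoning
  identity : ∀ i → i ℤ.* 1ℤ ℤ.* 1ℤ ≡ 1ℤ ℤ.* (1ℤ ℤ.* i)
  identity = ℤ.solve-∀

-- The ring solver takes no hypotheses, so identities that need x = 1 are given to it
-- together with the cofactor a of x - 1.
mod-one : ∀ {p q} a {x} → x ≡ 1ℚ → p ≡ q + a * (x - 1ℚ) → p ≡ q
mod-one {q = q} a refl p≡ = trans p≡ (trans (cong (_+_ q) (*-zeroʳ a)) (+-identityʳ q))

-- With `N = r + t`, dividing the recursion by `(N - 1)!` leaves
-- `N u(r,t) = t u(r,t-1) + r u(r-1,t) + 1` for `u = weight / N!`. The function
-- `(N + 1)/(t + 1) + H t` satisfies this and takes the value `N + 1` at `t = 0`.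
weight-closed : ∀ r t → fromℕ (weight r t) ≡
  fromℕ ((r ℕ.+ t) !) * ((fromℕ (r ℕ.+ t) + 1ℚ) * (+ 1 / suc t) + H t)
weight-closed r zero = begin
  fromℕ (suc r !)                                            ≡⟨ fromℕ-! r ⟩
  (fromℕ r + 1ℚ) * fromℕ (r !)                               ≡⟨ solve 2 (λ r f →
    (r :+ con 1ℚ) :* f := f :* ((r :+ con 1ℚ) :* con 1ℚ :+ con 0ℚ)) refl (fromℕ r) (fromℕ (r !)) ⟩
  fromℕ (r !) * ((fromℕ r + 1ℚ) * 1ℚ + 0ℚ)                   ≡⟨ cong (λ k → fromℕ (k !) * ((fromℕ k + 1ℚ) * 1ℚ + 0ℚ)) (sym (ℕ.+-identityʳ r)) ⟩
  fromℕ ((r ℕ.+ 0) !) * ((fromℕ (r ℕ.+ 0) + 1ℚ) * 1ℚ + 0ℚ)   ∎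
weight-closed zero (suc t) = begin
  fromℕ (suc t ℕ.* weight 0 t ℕ.+ t !)
    ≡⟨ fromℕ-+ (suc t ℕ.* weight 0 t) (t !) ⟩
  fromℕ (suc t ℕ.* weight 0 t) + F
    ≡⟨ cong (_+ F) (trans (fromℕ-* (suc t) (weight 0 t)) (cong₂ _*_ (fromℕ-suc t) (weight-closed 0 t))) ⟩
  (T + 1ℚ) * (F * ((T + 1ℚ) * i + h)) + F
    ≡⟨ mod-one (F * T) ([1+n]*1/[1+n]≡1 t) (solve 4 (λ T F i h →
         (T :+ con 1ℚ) :* (F :* ((T :+ con 1ℚ) :* i :+ h)) :+ F :=
         (T :+ con 1ℚ) :* F :* (con 1ℚ :+ (h :+ i)) :+ F :* T :* ((T :+ con 1ℚ) :* i :- con 1ℚ)) refl T F i h) ⟩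
  (T + 1ℚ) * F * (1ℚ + (h + i))
    ≡⟨ cong₂ (λ x y → x * (y + (h + i))) (sym (fromℕ-! t)) (sym ([1+n]*1/[1+n]≡1 (suc t))) ⟩
  fromℕ (suc t !) * ((fromℕ (suc t) + 1ℚ) * (+ 1 / suc (suc t)) + (h + i)) ∎
  where
  T = fromℕ t
  F = fromℕ (t !)
  i = + 1 / suc t
  h = H t
weight-closed (suc r) (suc t) = begin
  fromℕ (suc t ℕ.* weight (suc r) t ℕ.+ suc r ℕ.* weight r (suc t) ℕ.+ (suc r ℕ.+ t) !)
    ≡⟨ trans (fromℕ-+ (suc t ℕ.* weight (suc r) t ℕ.+ suc r ℕ.* weight r (suc t)) (suc (r ℕ.+ t) !))
             (cong (_+ F) (fromℕ-+ (suc t ℕ.* weight (suc r) t) (suc r ℕ.* weight r (suc t)))) ⟩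
  fromℕ (suc t ℕ.* weight (suc r) t) + fromℕ (suc r ℕ.* weight r (suc t)) + F
    ≡⟨ cong₂ (λ x y → x + y + F)
         (trans (fromℕ-* (suc t) (weight (suc r) t)) (cong₂ _*_ (fromℕ-suc t) (weight-closed (suc r) t)))
         (trans (fromℕ-* (suc r) (weight r (suc t))) (cong₂ _*_ (fromℕ-suc r)
           (trans (weight-closed r (suc t)) (cong (λ k → fromℕ (k !) * ((fromℕ k + 1ℚ) * j + (h + i))) (ℕ.+-suc r t))))) ⟩
  (T + 1ℚ) * (F * ((c + 1ℚ) * i + h)) + (R + 1ℚ) * (F * ((c + 1ℚ) * j + (h + i))) + F
    -- The solver would treat `c` as an independent variable, so it is first expressed through `R`
    -- and `T`.
    ≡⟨ cong (λ c → (T + 1ℚ) * (F * ((c + 1ℚ) * i + h)) + (R + 1ℚ) * (F * ((c + 1ℚ) * j + (h + i))) + F) c≡ ⟩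
  (T + 1ℚ) * (F * ((R + T + 1ℚ + 1ℚ) * i + h))
    + (R + 1ℚ) * (F * ((R + T + 1ℚ + 1ℚ) * j + (h + i))) + F
    ≡⟨ mod-one (F * (R + T + 1ℚ)) ([1+n]*1/[1+n]≡1 t) (solve 6 (λ R T F i j h →
         (T :+ con 1ℚ) :* (F :* ((R :+ T :+ con 1ℚ :+ con 1ℚ) :* i :+ h))
           :+ (R :+ con 1ℚ) :* (F :* ((R :+ T :+ con 1ℚ :+ con 1ℚ) :* j :+ (h :+ i))) :+ F :=
         (R :+ T :+ con 1ℚ :+ con 1ℚ) :* F
             :* ((R :+ con 1ℚ) :* j :+ (h :+ i) :+ con 1ℚ)
           :+ F :* (R :+ T :+ con 1ℚ) :* ((T :+ con 1ℚ) :* i :- con 1ℚ)) refl R T F i j h) ⟩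
  (R + T + 1ℚ + 1ℚ) * F * ((R + 1ℚ) * j + (h + i) + 1ℚ)
    -- The summand 1 is rewritten as `(t + 2) * j`, which joins `(r + 1) * j` to give the numerator
    -- `r + t + 3` of the closed form.
    ≡⟨ cong (λ x → (R + T + 1ℚ + 1ℚ) * F * ((R + 1ℚ) * j + (h + i) + x))
         (trans (sym ([1+n]*1/[1+n]≡1 (suc t))) (cong (λ x → (x + 1ℚ) * j) (fromℕ-suc t))) ⟩
  (R + T + 1ℚ + 1ℚ) * F * ((R + 1ℚ) * j + (h + i) + (T + 1ℚ + 1ℚ) * j)
    ≡⟨ solve 6 (λ R T F i j h →
         (R :+ T :+ con 1ℚ :+ con 1ℚ) :* F :* ((R :+ con 1ℚ) :* j :+ (h :+ i) :+ (T :+ con 1ℚ :+ con 1ℚ) :* j) :=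
         (R :+ T :+ con 1ℚ :+ con 1ℚ) :* F :* ((R :+ T :+ con 1ℚ :+ con 1ℚ :+ con 1ℚ) :* j :+ (h :+ i))) refl R T F i j h ⟩
  (R + T + 1ℚ + 1ℚ) * F * ((R + T + 1ℚ + 1ℚ + 1ℚ) * j + (h + i))
    ≡⟨ cong (λ x → (x + 1ℚ) * F * ((x + 1ℚ + 1ℚ) * j + (h + i))) (sym c≡) ⟩
  (c + 1ℚ) * F * ((c + 1ℚ + 1ℚ) * j + (h + i))
    ≡⟨ cong₂ (λ x y → x * ((y + 1ℚ) * j + (h + i))) (sym (fromℕ-! (suc (r ℕ.+ t)))) (sym (fromℕ-suc (suc (r ℕ.+ t)))) ⟩
  fromℕ (suc (suc (r ℕ.+ t)) !) * ((fromℕ (suc (suc (r ℕ.+ t))) + 1ℚ) * j + (h + i))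
    ≡⟨ cong (λ k → fromℕ (suc k !) * ((fromℕ (suc k) + 1ℚ) * j + (h + i))) (sym (ℕ.+-suc r t)) ⟩
  fromℕ (suc (r ℕ.+ suc t) !) * ((fromℕ (suc (r ℕ.+ suc t)) + 1ℚ) * j + (h + i)) ∎
  where
  R = fromℕ r
  T = fromℕ t
  c = fromℕ (suc (r ℕ.+ t))
  F = fromℕ (suc (r ℕ.+ t) !)
  i = + 1 / suc t
  j = + 1 / suc (suc t)
  h = H t
  c≡ : c ≡ R + T + 1ℚ
  c≡ = trans (fromℕ-suc (r ℕ.+ t)) (cong (_+ 1ℚ) (fromℕ-+ r t))

-- Along an empty stretch `r + k` is constant while `t` runs from `k` down to 1. The weights are
-- summed by `Σ 1/(t + 1) = H (k + 1) - 1` and `Σ H t = (k + 1) * H k - k`.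
totalWeight-⊥ : ∀ r k → fromℕ (totalWeight r (⊥ {k})) ≡
  fromℕ ((r ℕ.+ k) !) *
    ((fromℕ (r ℕ.+ k) + 1ℚ) * (H (suc k) - 1ℚ) + (fromℕ k + 1ℚ) * H k - fromℕ k)
totalWeight-⊥ r zero = solve 2 (λ f c → con 0ℚ :=
  f :* ((c :+ con 1ℚ) :* (con 0ℚ :+ con 1ℚ :- con 1ℚ) :+ (con 0ℚ :+ con 1ℚ) :* con 0ℚ :- con 0ℚ)) refl
  (fromℕ ((r ℕ.+ 0) !)) (fromℕ (r ℕ.+ 0))
totalWeight-⊥ r (suc k) = begin
  fromℕ (weight r (suc (vacancies (⊥ {k}))) ℕ.+ totalWeight (suc r) (⊥ {k}))
    ≡⟨ fromℕ-+ (weight r (suc (vacancies (⊥ {k})))) (totalWeight (suc r) (⊥ {k})) ⟩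
  fromℕ (weight r (suc (vacancies (⊥ {k})))) + fromℕ (totalWeight (suc r) (⊥ {k}))
    ≡⟨ cong₂ _+_
         (trans (cong (λ v → fromℕ (weight r (suc v))) (vacancies-⊥ k)) (weight-closed r (suc k)))
         (trans (totalWeight-⊥ (suc r) k)
           (cong (λ s → fromℕ (s !) * ((fromℕ s + 1ℚ) * (h + i - 1ℚ) + (fromℕ k + 1ℚ) * h - fromℕ k))
                 (sym (ℕ.+-suc r k)))) ⟩
  F * ((c + 1ℚ) * j + (h + i)) + F * ((c + 1ℚ) * (h + i - 1ℚ) + (K + 1ℚ) * h - K)
    ≡⟨ mod-one (- F) ([1+n]*1/[1+n]≡1 k) (solve 6 (λ F c K h i j →
         F :* ((c :+ con 1ℚ) :* j :+ (h :+ i)) :+ F :* ((c :+ con 1ℚ) :* (h :+ i :- con 1ℚ) :+ (K :+ con 1ℚ) :* h :- K) :=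
         F :* ((c :+ con 1ℚ) :* (h :+ i :+ j :- con 1ℚ) :+ (K :+ con 1ℚ :+ con 1ℚ) :* (h :+ i) :- (K :+ con 1ℚ))
           :+ (:- F) :* ((K :+ con 1ℚ) :* i :- con 1ℚ)) refl F c K h i j) ⟩
  F * ((c + 1ℚ) * (h + i + j - 1ℚ) + (K + 1ℚ + 1ℚ) * (h + i) - (K + 1ℚ))
    ≡⟨ cong (λ x → F * ((c + 1ℚ) * (h + i + j - 1ℚ) + (x + 1ℚ) * (h + i) - x)) (sym (fromℕ-suc k)) ⟩
  F * ((c + 1ℚ) * (h + i + j - 1ℚ) + (fromℕ (suc k) + 1ℚ) * (h + i) - fromℕ (suc k)) ∎
  where
  F = fromℕ ((r ℕ.+ suc k) !)
  c = fromℕ (r ℕ.+ suc k)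
  K = fromℕ k
  h = H k
  i = + 1 / suc k
  j = + 1 / suc (suc k)

-- The closed form of `A`, its equality with `L`, and the recurrence.

A-expanded : ∀ n → A n ≡ fromℕ (n !) * ((1ℚ + 1ℚ) * (fromℕ n + 1ℚ) * H n - (1ℚ + 1ℚ + 1ℚ + 1ℚ) * fromℕ n)
A-expanded n = cong₂ (λ x y → fromℕ (n !) * (x * H n - y))
  (trans (fromℕ-* 2 (n ℕ.+ 1)) (cong ((1ℚ + 1ℚ) *_) (fromℕ-+ n 1)))
  (fromℕ-* 4 n)

L≡A : ∀ n → fromℕ (L n) ≡ A n
L≡A zero    = refl
L≡A (suc n) = begin
  fromℕ (L N)
    ≡⟨ cong fromℕ (L-arrivals n) ⟩
  fromℕ a
    ≡⟨ solve 2 (λ a b → a := a :+ b :- b) refl (fromℕ a) (fromℕ (N ! ℕ.* (N ℕ.+ N))) ⟩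
  fromℕ a + fromℕ (N ! ℕ.* (N ℕ.+ N)) - fromℕ (N ! ℕ.* (N ℕ.+ N))
    ≡⟨ cong₂ _-_
         (trans (sym (fromℕ-+ a (N ! ℕ.* (N ℕ.+ N))))
           (trans (cong fromℕ (arrivals-1 N ⊥ (vacancies-⊥ N))) (totalWeight-⊥ 0 N)))
         (trans (fromℕ-* (N !) (N ℕ.+ N)) (cong (F *_) (fromℕ-+ N N))) ⟩
  F * ((c + 1ℚ) * (h + i - 1ℚ) + (c + 1ℚ) * h - c) - F * (c + c)
    -- Since `(c + 1) * i = 1`, the term `(c + 1) * (h + i - 1)` equals `(c + 1) * h - c`. With the
    -- remaining `- c` and `- (c + c)` this gives the `- 4 c` of `A`.
    ≡⟨ mod-one F ([1+n]*1/[1+n]≡1 N) (solve 4 (λ F c h i →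
         F :* ((c :+ con 1ℚ) :* (h :+ i :- con 1ℚ) :+ (c :+ con 1ℚ) :* h :- c) :- F :* (c :+ c) :=
         F :* (con (1ℚ + 1ℚ) :* (c :+ con 1ℚ) :* h :- con (1ℚ + 1ℚ + 1ℚ + 1ℚ) :* c)
           :+ F :* ((c :+ con 1ℚ) :* i :- con 1ℚ)) refl F c h i) ⟩
  F * ((1ℚ + 1ℚ) * (c + 1ℚ) * h - (1ℚ + 1ℚ + 1ℚ + 1ℚ) * c)
    ≡⟨ sym (A-expanded N) ⟩
  A N ∎
  where
  N = suc n
  a = arrivals 1 (⊥ {N}) N
  F = fromℕ (N !)
  c = fromℕ N
  h = H N
  i = + 1 / suc N

A-recurrence : SatisfiesRecurrence A
A-recurrence = refl , refl , step
  where
  step : ∀ n → n ℕ.≥ 2 →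
    A n ≡ fromℕ (2 ℕ.* n) * A (n ∸ 1) - fromℕ (n ℕ.* (n ∸ 1)) * A (n ∸ 2) + fromℕ (2 ℕ.* (n ∸ 1) !)
  step (suc zero) (s≤s ())
  step (suc (suc k)) _ = begin
    A (suc (suc k))
      ≡⟨ A-expanded (suc (suc k)) ⟩
    fromℕ (suc (suc k) !) * (two * (fromℕ (suc (suc k)) + 1ℚ) * (h + i + j) - four * fromℕ (suc (suc k)))
      ≡⟨ cong₂ (λ x y → x * (two * (y + 1ℚ) * (h + i + j) - four * y))
           (trans (fromℕ-! (suc k)) (cong₂ (λ x y → (x + 1ℚ) * y) (fromℕ-suc k) (fromℕ-! k)))
           2+k ⟩
    (c + 1ℚ + 1ℚ) * ((c + 1ℚ) * F) * (two * (c + 1ℚ + 1ℚ + 1ℚ) * (h + i + j) - four * (c + 1ℚ + 1ℚ))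
      -- For `n = k + 2` everything is expressed through `h = H (n - 2)`, with `i = 1/(n - 1)` and
      -- `j = 1/n`. The two nested uses of `mod-one` discharge `n * j = 1` and `(n - 1) * i = 1`;
      -- the cofactors are read off from the coefficients of `j` and `i`.
      ≡⟨ mod-one (two * (c + 1ℚ + 1ℚ + 1ℚ) * ((c + 1ℚ) * F))
             (trans (cong (λ x → (x + 1ℚ) * j) (sym (fromℕ-suc k))) ([1+n]*1/[1+n]≡1 (suc k)))
          (mod-one (- (two * (c + 1ℚ + 1ℚ) * ((c + 1ℚ) * F))) ([1+n]*1/[1+n]≡1 k)
          (solve 5 (λ F c h i j →
            let 1' = con 1ℚ; 2' = con two; 4' = con four
                c1 = c :+ 1'; c2 = c1 :+ 1' in
            c2 :* (c1 :* F) :* (2' :* (c2 :+ 1') :* (h :+ i :+ j) :- 4' :* c2) :=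
            (2' :* c2) :* (c1 :* F :* (2' :* (c1 :+ 1') :* (h :+ i) :- 4' :* c1))
              :- c2 :* c1 :* (F :* (2' :* (c :+ 1') :* h :- 4' :* c)) :+ 2' :* (c1 :* F)
              :+ 2' :* (c2 :+ 1') :* (c1 :* F) :* (c2 :* j :- 1')
              :+ (:- (2' :* c2 :* (c1 :* F))) :* (c1 :* i :- 1')) refl F c h i j)) ⟩
    two * (c + 1ℚ + 1ℚ) * ((c + 1ℚ) * F * (two * (c + 1ℚ + 1ℚ) * (h + i) - four * (c + 1ℚ)))
      - (c + 1ℚ + 1ℚ) * (c + 1ℚ) * (F * (two * (c + 1ℚ) * h - four * c)) + two * ((c + 1ℚ) * F)
      ≡⟨ cong₂ _+_ (cong₂ _-_
           (cong₂ _*_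
             (sym (trans (fromℕ-* 2 (suc (suc k))) (cong (two *_) 2+k)))
             (sym (trans (A-expanded (suc k))
               (cong₂ (λ x y → x * (two * (y + 1ℚ) * (h + i) - four * y)) (fromℕ-! k) (fromℕ-suc k)))))
           (cong₂ _*_
             (sym (trans (fromℕ-* (suc (suc k)) (suc k)) (cong₂ _*_ 2+k (fromℕ-suc k))))
             (sym (A-expanded k))))
           (sym (trans (fromℕ-* 2 (suc k !)) (cong (two *_) (fromℕ-! k)))) ⟩
    fromℕ (2 ℕ.* suc (suc k)) * A (suc k) - fromℕ (suc (suc k) ℕ.* suc k) * A k + fromℕ (2 ℕ.* suc k !) ∎
    where
    two four : ℚ
    two = 1ℚ + 1ℚ
    four = 1ℚ + 1ℚ + 1ℚ + 1ℚ
    c = fromℕ k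
    F = fromℕ (k !)
    h = H k
    i = + 1 / suc k
    j = + 1 / suc (suc k)
    2+k : fromℕ (suc (suc k)) ≡ c + 1ℚ + 1ℚ
    2+k = trans (fromℕ-suc (suc k)) (cong (_+ 1ℚ) (fromℕ-suc k))

SatisfiesRecurrence-resp-≗ : ∀ {f g} → f ≗ g → SatisfiesRecurrence f → SatisfiesRecurrence g
SatisfiesRecurrence-resp-≗ {f} {g} f≗g (f₀ , f₁ , step) =
  trans (sym (f≗g 0)) f₀ , trans (sym (f≗g 1)) f₁ , λ n n≥2 → begin
    g n  ≡⟨ sym (f≗g n) ⟩
    f n  ≡⟨ step n n≥2 ⟩
    fromℕ (2 ℕ.* n) * f (n ∸ 1) - fromℕ (n ℕ.* (n ∸ 1)) * f (n ∸ 2) + fromℕ (2 ℕ.* (n ∸ 1) !)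
      ≡⟨ cong₂ (λ x y → fromℕ (2 ℕ.* n) * x - fromℕ (n ℕ.* (n ∸ 1)) * y + fromℕ (2 ℕ.* (n ∸ 1) !))
           (f≗g (n ∸ 1)) (f≗g (n ∸ 2)) ⟩
    fromℕ (2 ℕ.* n) * g (n ∸ 1) - fromℕ (n ℕ.* (n ∸ 1)) * g (n ∸ 2) + fromℕ (2 ℕ.* (n ∸ 1) !) ∎

mainTheorem2 : SatisfiesRecurrence A × SatisfiesRecurrence (λ n → fromℕ (L n))
mainTheorem2 = A-recurrence , SatisfiesRecurrence-resp-≗ (λ n → sym (L≡A n)) A-recurrence
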